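{- Let $t_0=\{\mathit{MH}\}$ be a trait consisting of a single abstract method header, let $t_1=\{\mathit{Ms}_1\},\dots,t_n=\{\mathit{Ms}_n\}$ be traits, and let $C=t_0+\dots+t_n$ be a class declaration, in a program of the trait calculus described in the context. If $t_0,\dots,t_n$ are well-typed (i.e. $\mathit{Ds};t_i\vdash\mathit{Ds}(t_i):\mathit{OK}$) and the declarations $t_0=\{\mathit{MH}\},t_1=\{\mathit{Ms}_1\},\dots,t_n=\{\mathit{Ms}_n\},C=t_0+\dots+t_n$ flatten to $t_0=\{\mathit{MH}\},t_1=\{\mathit{Ms}_1\},\dots,t_n=\{\mathit{Ms}_n\},C=\mathit{Body}$, then $C=\mathit{Body}$ is well-typed, i.e. $\mathit{Body}$ satisfies the typing-and-verification judgment $\vdash\mathit{Body}:\mathit{OK}$ under name $C$ in the flattened program.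
   Context: Trait calculus (\textsc{TraitCbC}). A program is a list $\mathit{Ds}$ of declarations $\mathit{Name}=E$ (names unique, no circular trait definitions), where $\mathit{Name}$ is a trait name $t$ or class name $C$, and $E::=\mathit{Body}\mid t\mid E+E\mid E[\mathtt{makeAbstract}\ m]$. A body is $\{\mathtt{interface}?\ [\mathit{Cs}]\ \mathit{Ms}\}$ with implemented interfaces $\mathit{Cs}$ and methods $\mathit{Ms}$ with distinct names. A method is $\mathit{MH}\ e?;$ (abstract if $e$ absent) with header $S\ \mathtt{method}\ C\ m(C_1x_1\dots C_nx_n)$; $S$ has precondition $\mathit{Pre}(S)$ and postcondition $\mathit{Post}(S)$ in a parametric logic supporting a commutative, associative conjunction $\&$ and transitive implication $\Rightarrow$. Expressions: $e::=x\mid e.m(e_1\dots e_n)\mid\mathtt{new}\ C(e_1\dots e_n)$; fields are emulated by argument-less abstract methods (getters). The underlying verification is assumed sound and modular. Typing judgment $\Gamma\vdash e:C\dashv P\models P'$ (knowledge $P$, obligation $P'$): variables give $\Gamma\vdash x:\Gamma(x)\dashv\mathtt{result}:\Gamma(x)\&\mathtt{result}=x\models\mathit{true}$; a call $e_0.m(e_1\dots e_n)$ to a method $S\ \mathtt{method}\ C\ m(C_1x_1\dots C_nx_n)$ of $C_0$, with $\Gamma\vdash e_i:C_i\dashv P_i\models P'_i$, fresh $x'_i$ and $S'=S[\mathtt{this}:=x'_0,x_i:=x'_i]$, has type $C$, knowledge $\mathtt{result}:C\&P_0[\mathtt{result}:=x'_0]\&\dots\&P_n[\mathtt{result}:=x'_n]\&(\mathit{Pre}(S')\Rightarrow\mathit{Post}(S'))$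 and obligation $P'_0\&\dots\&P'_n\&\mathit{Pre}(S')$; $\mathtt{new}\ C(e_1\dots e_n)$, with getters $S_i\ \mathtt{method}\ C_i\ x_i()$ of $C$, has type $C$, knowledge $\mathtt{result}:C\&\bigwedge_i(P_i[\mathtt{result}:=x'_i]\&(\mathit{Pre}(S'_i)\Rightarrow\mathtt{result}.x_i()=x'_i))$ and obligation $\bigwedge_iP'_i\&\bigwedge_i\mathit{Pre}(S'_i)$, $S'_i=S_i[\mathtt{this}:=\mathtt{result}]$; subsumption to supertypes. A concrete method $S\ \mathtt{method}\ C\ m(C_1x_1\dots C_nx_n)\ e;$ satisfies $\mathit{Ds};\mathit{Name}\vdash M:\mathit{OK}$ iff, for $\Gamma=\mathtt{this}:\mathit{Name},x_i:C_i$, $\Gamma\vdash e:C\dashv P\models P'$ and the verifier proves $\mathit{Ds}\vdash(\Gamma\&\mathit{Pre}(S)\&P)\models(P'\&\mathit{Post}(S))$; abstract methods are always OK; a body is OK (well-typed) iff all its methods are. Body composition $\{[\mathit{Cs}_1]\mathit{Ms}_1\}+\{[\mathit{Cs}_2]\mathit{Ms}_2\}=\{[\mathit{Cs}_1\cup\mathit{Cs}_2]\mathit{Ms}_1+\mathit{Ms}_2\}$: methods present in only one list are kept; a concrete method (spec $S$) plus an abstract one (spec $S'$) with the same name yields the concrete one if $\mathit{Pre}(S')\Rightarrow\mathit{Pre}(S)$ and $\mathit{Post}(S)\Rightarrow\mathit{Post}(S')$; two abstract methods yield the one with the stronger specification in this sense (the first if it qualifies); otherwise (e.g. two concrete methods)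 composition is undefined. Flattening: $D_1\dots D_n$ flattens to $D'_1\dots D'_n$ if $D'_1\dots D'_n\vdash D_i\Downarrow D'_i$ for all $i$. $\mathit{Ds}\vdash\mathit{Name}=E\Downarrow\mathit{Name}=\mathit{Body}$ if $\mathit{Ds};\mathit{Name}\vdash E\Downarrow\mathit{Body}$ and, when $\mathit{Name}$ is a class, all abstract methods of $\mathit{Body}$ are argument-less getters. Trait expressions flatten as: a body flattens to itself extended by the headers of the interface methods of $\mathit{Cs}$ not already present, provided the result is OK; $t\Downarrow\mathit{Ds}(t)$; $E_1+E_2\Downarrow\mathit{Body}_1+\mathit{Body}_2$ if $E_i\Downarrow\mathit{Body}_i$; $E[\mathtt{makeAbstract}\ m]\Downarrow\mathit{Body}[\mathtt{makeAbstract}\ m]$ (implementation of $m$ removed) if $E\Downarrow\mathit{Body}$. -}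

module Defs where

open import Level using (Level; suc; _⊔_)
open import Data.Bool using (Bool; true; false)
open import Data.Empty using (⊥)
open import Data.Fin using (Fin)
open import Data.List using (List; []; _∷_; _++_; map; foldr; foldl; allFin; mapMaybe)
open import Data.List.Membership.Propositional using (_∈_; _∉_)
open import Data.List.Relation.Binary.Pointwise using (Pointwise)
open import Data.List.Relation.Binary.Subset.Propositional using (_⊆_)
open import Data.List.Relation.Unary.All using (All)
open import Data.List.Relation.Unary.Unique.Propositional using (Unique)
open import Data.Maybe using (Maybe; just; nothing)
open import Data.Nat using (ℕ)
open import Data.Product using (∃-syntax; _×_; _,_; proj₁; proj₂)
open import Data.Sum using (_⊎_)
open import Data.Unit.Polymorphic using (⊤)
open import Data.Vec as Vec using (Vec; []; _∷_)
open import Function using (_∘_; _⇔_)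
open import Relation.Binary.Construct.Closure.ReflexiveTransitive using (Star)
open import Relation.Binary.Construct.Closure.Transitive using (TransClosure)
open import Relation.Binary.PropositionalEquality using (_≡_)
open import Relation.Nullary using (¬_)

TraitName ClassName MethodName : Set
TraitName  = ℕ
ClassName  = ℕ
MethodName = ℕ

data Name : Set where
  trait : TraitName → Name
  class : ClassName → Name

-- The parametric logic.  `Formula V` is the set of formulas with free
-- variables in V, and `P [ σ ]` is simultaneous substitution of variables for
-- variables.  `x · m ≐ y` is the atom  x.m() = y.  `Valid (P ⇒ Q)` is how the
-- side condition "P ⇒ Q" of trait composition is read.
record Logic (f v : Level) : Set (suc (f ⊔ v)) where
  infix  8 _[_]
  infix  7 _∶_ _≐_ _·_≐_
  infixr 6 _&_
  infixr 5 _⇒_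
  field
    Formula : Set → Set f
    true′   : ∀ {V} → Formula V
    _&_ _⇒_ : ∀ {V} → Formula V → Formula V → Formula V
    _∶_     : ∀ {V} → V → Name → Formula V
    _≐_     : ∀ {V} → V → V → Formula V
    _·_≐_   : ∀ {V} → V → MethodName → V → Formula V
    _[_]    : ∀ {V W} → Formula V → (V → W) → Formula W
    Valid   : ∀ {V} → Formula V → Set v

    []-true : ∀ {V W} (σ : V → W) → true′ [ σ ] ≡ true′
    []-&    : ∀ {V W} (P Q : Formula V) (σ : V → W) → (P & Q) [ σ ] ≡ P [ σ ] & Q [ σ ]
    []-⇒    : ∀ {V W} (P Q : Formula V) (σ : V → W) → (P ⇒ Q) [ σ ] ≡ (P [ σ ] ⇒ Q [ σ ])
    []-∶    : ∀ {V W} (x : V) (N : Name) (σ : V → W) → (x ∶ N) [ σ ] ≡ (σ x ∶ N)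
    []-≐    : ∀ {V W} (x y : V) (σ : V → W) → (x ≐ y) [ σ ] ≡ (σ x ≐ σ y)
    []-·≐   : ∀ {V W} (x y : V) (m : MethodName) (σ : V → W) → (x · m ≐ y) [ σ ] ≡ (σ x · m ≐ σ y)

    valid-[] : ∀ {V W} {P : Formula V} (σ : V → W) → Valid P → Valid (P [ σ ])
    ⇒-refl   : ∀ {V} {P : Formula V} → Valid (P ⇒ P)
    ⇒-trans  : ∀ {V} {P Q R : Formula V} → Valid (P ⇒ Q) → Valid (Q ⇒ R) → Valid (P ⇒ R)
    true-I   : ∀ {V} {P : Formula V} → Valid (P ⇒ true′)
    &-comm   : ∀ {V} {P Q : Formula V} → Valid (P & Q ⇒ Q & P)
    &-assoc  : ∀ {V} {P Q R : Formula V} → Valid ((P & Q) & R ⇒ P & (Q & R))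
    &-E      : ∀ {V} {P Q : Formula V} → Valid (P & Q ⇒ P)
    &-I      : ∀ {V} {P Q R : Formula V} → Valid (P ⇒ Q) → Valid (P ⇒ R) → Valid (P ⇒ Q & R)
    curry    : ∀ {V} {P Q R : Formula V} → Valid (P & Q ⇒ R) → Valid (P ⇒ (Q ⇒ R))
    uncurry  : ∀ {V} {P Q R : Formula V} → Valid (P ⇒ (Q ⇒ R)) → Valid (P & Q ⇒ R)

  ⋀ : ∀ {V} → List (Formula V) → Formula V
  ⋀ = foldr _&_ true′

-- Program variables of a method with n parameters, which are identified by
-- position.
data Var (n : ℕ) : Set where
  this : Var n
  arg  : Fin n → Var n

data WithResult (V : Set) : Set where
  result : WithResult V
  var    : V → WithResult V

-- The variables x′ introduced by the typing rules form a sort of their own, so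
-- they cannot clash with program variables.
data Local (n : ℕ) : Set where
  prog  : Var n → Local n
  fresh : ℕ → Local n

LVar : ℕ → Set
LVar n = WithResult (Local n)

data Expr (n : ℕ) : Set where
  var  : Var n → Expr n
  call : ∀ {k} → Expr n → MethodName → Vec (Expr n) k → Expr n
  new  : ∀ {k} → ClassName → Vec (Expr n) k → Expr n

module Calculus {f v : Level} (L : Logic f v) where
  open Logic L

  record Spec (n : ℕ) : Set f where
    constructor spec
    field
      Pre  : Formula (Var n)
      Post : Formula (WithResult (Var n))
  open Spec public

  record Header : Set f where
    constructor header
    field
      name    : MethodName
      {arity} : ℕ
      params  : Vec ClassName arity
      ret     : ClassName
      hspec   : Spec arity
  open Header public

  record Method : Set f where
    constructor method
    field
      head : Header
      impl : Maybe (Expr (arity head))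
  open Method public

  mname : Method → MethodName
  mname = name ∘ head

  abstractMethod : Header → Method
  abstractMethod H = method H nothing

  record Body : Set f where
    constructor body
    field
      interface? : Bool
      implements : List ClassName
      methods    : List Method
  open Body public

  ⟨_⟩ : List Method → Body
  ⟨ Ms ⟩ = body false [] Ms

  infixl 6 _+ᴱ_
  data TraitExpr : Set f where
    lit          : Body → TraitExpr
    ref          : TraitName → TraitExpr
    _+ᴱ_         : TraitExpr → TraitExpr → TraitExpr
    makeAbstract : TraitExpr → MethodName → TraitExpr

  Decl FlatDecl : Set f
  Decl     = Name × TraitExpr
  FlatDecl = Name × Body

  Program FlatProgram : Set f
  Program     = List Decl
  FlatProgram = List FlatDecl

  Mentions : TraitExpr → TraitName → Set
  Mentions (lit _)            t = ⊥
  Mentions (ref t′)           t = t′ ≡ t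
  Mentions (E₁ +ᴱ E₂)         t = Mentions E₁ t ⊎ Mentions E₂ t
  Mentions (makeAbstract E _) t = Mentions E t

  DependsOn : Program → TraitName → TraitName → Set f
  DependsOn Ds t t′ = ∃[ E ] (trait t , E) ∈ Ds × Mentions E t′

  DistinctMethods : TraitExpr → Set
  DistinctMethods (lit B)            = Unique (map mname (methods B))
  DistinctMethods (ref _)            = ⊤
  DistinctMethods (E₁ +ᴱ E₂)         = DistinctMethods E₁ × DistinctMethods E₂
  DistinctMethods (makeAbstract E _) = DistinctMethods E

  record WellFormed (Ds : Program) : Set f where
    field
      uniqueNames     : Unique (map proj₁ Ds)
      acyclic         : ∀ t → ¬ TransClosure (DependsOn Ds) t t
      distinctMethods : All (DistinctMethods ∘ proj₂) Ds

  -- The first specification is the stronger one.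
  _⊑_ : ∀ {n} → Spec n → Spec n → Set v
  S ⊑ S′ = Valid (Pre S′ ⇒ Pre S) × Valid (Post S ⇒ Post S′)

  data _≼_ : Header → Header → Set (f ⊔ v) where
    refines : ∀ {m k} {Cs : Vec ClassName k} {C} {S S′ : Spec k} →
              S ⊑ S′ → header m Cs C S ≼ header m Cs C S′

  data _+ᵐ_≔_ : Method → Method → Method → Set (f ⊔ v) where
    concrete-abstract : ∀ {H₁ H₂ e} → H₁ ≼ H₂ →
      method H₁ (just e) +ᵐ method H₂ nothing ≔ method H₁ (just e)
    abstract-concrete : ∀ {H₁ H₂ e} → H₂ ≼ H₁ →
      method H₁ nothing +ᵐ method H₂ (just e) ≔ method H₂ (just e)
    abstract-first : ∀ {H₁ H₂} → H₁ ≼ H₂ →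
      method H₁ nothing +ᵐ method H₂ nothing ≔ method H₁ nothing
    abstract-second : ∀ {H₁ H₂} → ¬ (H₁ ≼ H₂) → H₂ ≼ H₁ →
      method H₁ nothing +ᵐ method H₂ nothing ≔ method H₂ nothing

  data _+ˢ_≔_ : List Method → List Method → List Method → Set (f ⊔ v) where
    done  : ∀ {Ms} → [] +ˢ Ms ≔ Ms
    keep  : ∀ {M Ms₁ Ms₂ Ms} → mname M ∉ map mname Ms₂ →
            Ms₁ +ˢ Ms₂ ≔ Ms → (M ∷ Ms₁) +ˢ Ms₂ ≔ (M ∷ Ms)
    merge : ∀ {M₁ M₂ M Ms₁ Ms Ms₂ Ms₂′} → M₁ +ᵐ M₂ ≔ M →
            Ms₁ +ˢ (Ms₂ ++ Ms₂′) ≔ Ms →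
            (M₁ ∷ Ms₁) +ˢ (Ms₂ ++ M₂ ∷ Ms₂′) ≔ (M ∷ Ms)

  -- Lists of interfaces are used only through membership, so _++_ is union.
  data _+ᴮ_≔_ : Body → Body → Body → Set (f ⊔ v) where
    compose : ∀ {Cs₁ Cs₂ Ms₁ Ms₂ Ms} → Ms₁ +ˢ Ms₂ ≔ Ms →
              body false Cs₁ Ms₁ +ᴮ body false Cs₂ Ms₂ ≔ body false (Cs₁ ++ Cs₂) Ms

  data MakeAbstract : Body → MethodName → Body → Set f where
    removeImpl : ∀ {i Cs Ms Ms′ H e?} →
      MakeAbstract (body i Cs (Ms ++ method H e? ∷ Ms′)) (name H)
                   (body i Cs (Ms ++ method H nothing ∷ Ms′))

  -- B offers every method of B′, with the same signature and an at least as
  -- strong specification, and implements every interface of B′.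
  _Provides_ : Body → Body → Set (f ⊔ v)
  B Provides B′ =
    implements B′ ⊆ implements B ×
    (∀ M′ → M′ ∈ methods B′ → ∃[ M ] M ∈ methods B × head M ≼ head M′)

  -- The verifier.  The first four laws say that what it proves is a consequence
  -- relation of the logic.  The last one is modularity: a trait is verified
  -- against the contracts it declares for `this`, so an instance of any class
  -- (or trait) that offers these contracts may be used as an instance of it.
  record Verifier (p : Level) : Set (suc (f ⊔ v ⊔ p)) where
    infix 4 _⊢_⊨_
    field
      _⊢_⊨_  : FlatProgram → ∀ {V} → Formula V → Formula V → Set p
      logical : ∀ {Ds V} {P Q : Formula V} → Valid (P ⇒ Q) → Ds ⊢ P ⊨ Q
      cut     : ∀ {Ds V} {P Q R : Formula V} → Ds ⊢ P ⊨ Q → Ds ⊢ Q ⊨ R → Ds ⊢ P ⊨ R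
      conj    : ∀ {Ds V} {P Q R : Formula V} → Ds ⊢ P ⊨ Q → Ds ⊢ P ⊨ R → Ds ⊢ P ⊨ Q & R
      subst   : ∀ {Ds V W} {P Q : Formula V} (σ : V → W) → Ds ⊢ P ⊨ Q → Ds ⊢ P [ σ ] ⊨ Q [ σ ]
      modular : ∀ {Ds N B t B′ V} (x : V) →
                (N , B) ∈ Ds → interface? B ≡ false → (trait t , B′) ∈ Ds → B Provides B′ →
                Ds ⊢ x ∶ N ⊨ x ∶ trait t

  record Getter : Set f where
    constructor getter
    field
      gname : MethodName
      gret  : ClassName
      gspec : Spec 0
  open Getter public

  getterMethod : Getter → Method
  getterMethod g = abstractMethod (header (gname g) [] (gret g) (gspec g))

  ifAbstract : Method → Maybe Method
  ifAbstract (method H nothing)  = just (method H nothing)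
  ifAbstract (method H (just _)) = nothing

  abstractMethods : Body → List Method
  abstractMethods B = mapMaybe ifAbstract (methods B)

  Implements : FlatProgram → Name → Name → Set f
  Implements Ds N N′ = ∃[ B ] ∃[ C ] N′ ≡ class C × (N , B) ∈ Ds × C ∈ implements B

  _⊢_<:_ : FlatProgram → Name → Name → Set f
  Ds ⊢ N <: N′ = Star (Implements Ds) N N′

  Ctx : ℕ → Set
  Ctx n = Var n → Name

  ctx : ∀ {n} → Name → Vec ClassName n → Ctx n
  ctx N Cs this    = N
  ctx N Cs (arg i) = class (Vec.lookup Cs i)

  program : ∀ {n} → Var n → LVar n
  program x = var (prog x)

  ctxFormula : ∀ {n} → Ctx n → Formula (LVar n)
  ctxFormula {n} Γ =
    (program this ∶ Γ this) & ⋀ (map (λ i → program (arg i) ∶ Γ (arg i)) (allFin n))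

  liftResult : ∀ {V n} → (V → LVar n) → WithResult V → LVar n
  liftResult σ result  = result
  liftResult σ (var x) = σ x

  preAt : ∀ {k n} → Spec k → (Var k → LVar n) → Formula (LVar n)
  preAt S σ = Pre S [ σ ]

  postAt : ∀ {k n} → Spec k → (Var k → LVar n) → Formula (LVar n)
  postAt S σ = Post S [ liftResult σ ]

  _[result:=_] : ∀ {n} → Formula (LVar n) → ℕ → Formula (LVar n)
  P [result:= x ] = P [ (λ { result → var (fresh x) ; (var y) → var y }) ]

  [this:=_,args:=_] : ∀ {k n} → ℕ → Vec ℕ k → Var k → LVar n
  [this:= x₀ ,args:= xs ] this    = var (fresh x₀)
  [this:= x₀ ,args:= xs ] (arg i) = var (fresh (Vec.lookup xs i))

  [this:=result] : ∀ {n} → Var 0 → LVar n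
  [this:=result] this = result

  ⋀ᵛ : ∀ {n k} → Vec (Formula (LVar n)) k → Formula (LVar n)
  ⋀ᵛ = ⋀ ∘ Vec.toList

  -- The list after ∣ collects the variables that the derivation introduces.
  -- Freshness is the requirement that it has no repetitions.
  mutual
    data _,_⊢_∶_⊣_⊨_∣_ (Ds : FlatProgram) {n : ℕ} (Γ : Ctx n) :
           Expr n → Name → Formula (LVar n) → Formula (LVar n) → List ℕ → Set f where

      t-var : ∀ x → Ds , Γ ⊢ var x ∶ Γ x ⊣ (result ∶ Γ x & result ≐ program x) ⊨ true′ ∣ []

      t-call : ∀ {N B M e₀ P₀ P₀′ F₀ F x₀} {es : Vec (Expr n) (arity (head M))} {Ps Ps′ xs} →
        Ds , Γ ⊢ e₀ ∶ N ⊣ P₀ ⊨ P₀′ ∣ F₀ →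
        (N , B) ∈ Ds → M ∈ methods B →
        Ds , Γ ⊢* es ∶ params (head M) ⊣ Ps ⊨ Ps′ ∣ F →
        Unique (x₀ ∷ Vec.toList xs ++ F₀ ++ F) →
        let C = class (ret (head M))
            S = hspec (head M)
            σ = [this:= x₀ ,args:= xs ]
        in
        Ds , Γ ⊢ call e₀ (mname M) es ∶ C
          ⊣ (result ∶ C & P₀ [result:= x₀ ] & ⋀ᵛ (Vec.zipWith _[result:=_] Ps xs)
              & (preAt S σ ⇒ postAt S σ))
          ⊨ (P₀′ & ⋀ᵛ Ps′ & preAt S σ)
          ∣ (x₀ ∷ Vec.toList xs ++ F₀ ++ F)

      t-new : ∀ {C B k F} {gs : Vec Getter k} {es : Vec (Expr n) k} {Ps Ps′ xs} →
        (class C , B) ∈ Ds → interface? B ≡ false →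
        abstractMethods B ≡ map getterMethod (Vec.toList gs) →
        Ds , Γ ⊢* es ∶ Vec.map gret gs ⊣ Ps ⊨ Ps′ ∣ F →
        Unique (Vec.toList xs ++ F) →
        let pre = λ g → preAt (gspec g) [this:=result] in
        Ds , Γ ⊢ new C es ∶ class C
          ⊣ (result ∶ class C
              & ⋀ᵛ (Vec.zipWith _&_
                      (Vec.zipWith _[result:=_] Ps xs)
                      (Vec.zipWith (λ g x → pre g ⇒ result · gname g ≐ var (fresh x)) gs xs)))
          ⊨ (⋀ᵛ Ps′ & ⋀ᵛ (Vec.map pre gs))
          ∣ (Vec.toList xs ++ F)

      t-sub : ∀ {e N N′ P P′ F} →
        Ds , Γ ⊢ e ∶ N ⊣ P ⊨ P′ ∣ F → Ds ⊢ N <: N′ →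
        Ds , Γ ⊢ e ∶ N′ ⊣ P ⊨ P′ ∣ F

    data _,_⊢*_∶_⊣_⊨_∣_ (Ds : FlatProgram) {n : ℕ} (Γ : Ctx n) :
           ∀ {k} → Vec (Expr n) k → Vec ClassName k →
           Vec (Formula (LVar n)) k → Vec (Formula (LVar n)) k → List ℕ → Set f where
      []  : Ds , Γ ⊢* [] ∶ [] ⊣ [] ⊨ [] ∣ []
      _∷_ : ∀ {k e C P P′ F F′} {es : Vec (Expr n) k} {Cs Ps Ps′} →
        Ds , Γ ⊢ e ∶ class C ⊣ P ⊨ P′ ∣ F →
        Ds , Γ ⊢* es ∶ Cs ⊣ Ps ⊨ Ps′ ∣ F′ →
        Ds , Γ ⊢* e ∷ es ∶ C ∷ Cs ⊣ P ∷ Ps ⊨ P′ ∷ Ps′ ∣ (F ++ F′)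

  InterfaceHeader : FlatProgram → List ClassName → Header → Set f
  InterfaceHeader Ds Cs H =
    ∃[ C ] ∃[ B ] C ∈ Cs × (class C , B) ∈ Ds × H ∈ map head (methods B)

  IsInterface : FlatProgram → ClassName → Set f
  IsInterface Ds C = ∃[ B ] (class C , B) ∈ Ds × interface? B ≡ true

  record MissingHeaders (Ds : FlatProgram) (Cs : List ClassName) (Ms : List Method)
                        (Hs : List Header) : Set f where
    field
      interfaces : All (IsInterface Ds) Cs
      missing    : ∀ H → H ∈ Hs ⇔ (InterfaceHeader Ds Cs H × name H ∉ map mname Ms)
      distinct   : Unique (map mname Ms ++ map name Hs)

  -- Interfaces are also named by class names, but may have arbitrary abstract
  -- methods.
  ClassComplete : Name → Body → Set f
  ClassComplete (trait t) B = ⊤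
  ClassComplete (class C) B = interface? B ≡ false →
    ∀ M → M ∈ abstractMethods B → ∃[ g ] M ≡ getterMethod g

  module Verification {p : Level} (𝒱 : Verifier p) where
    open Verifier 𝒱

    MethodOK : FlatProgram → Name → Method → Set (f ⊔ p)
    MethodOK Ds N (method H nothing)  = ⊤
    MethodOK Ds N (method H (just e)) =
      let Γ = ctx N (params H)
          S = hspec H
      in
      ∃[ P ] ∃[ P′ ] ∃[ F ]
        Ds , Γ ⊢ e ∶ class (ret H) ⊣ P ⊨ P′ ∣ F ×
        Ds ⊢ ctxFormula Γ & preAt S program & P ⊨ P′ & postAt S program

    BodyOK : FlatProgram → Name → Body → Set (f ⊔ p)
    BodyOK Ds N B = All (MethodOK Ds N) (methods B)

    data _؛_⊢_⇓_ (Ds : FlatProgram) (N : Name) : TraitExpr → Body → Set (f ⊔ v ⊔ p) where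
      flat-body : ∀ {i Cs Ms Hs} → MissingHeaders Ds Cs Ms Hs →
        let B = body i Cs (Ms ++ map abstractMethod Hs) in
        BodyOK Ds N B → Ds ؛ N ⊢ lit (body i Cs Ms) ⇓ B
      flat-ref : ∀ {t B} → (trait t , B) ∈ Ds → Ds ؛ N ⊢ ref t ⇓ B
      flat-+ : ∀ {E₁ E₂ B₁ B₂ B} → Ds ؛ N ⊢ E₁ ⇓ B₁ → Ds ؛ N ⊢ E₂ ⇓ B₂ →
        B₁ +ᴮ B₂ ≔ B → Ds ؛ N ⊢ E₁ +ᴱ E₂ ⇓ B
      flat-makeAbstract : ∀ {E m B B′} → Ds ؛ N ⊢ E ⇓ B → MakeAbstract B m B′ →
        Ds ؛ N ⊢ makeAbstract E m ⇓ B′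

    FlattensDecl : FlatProgram → Decl → FlatDecl → Set (f ⊔ v ⊔ p)
    FlattensDecl Ds (N , E) (N′ , B) = N ≡ N′ × Ds ؛ N ⊢ E ⇓ B × ClassComplete N B

    _FlattensTo_ : Program → FlatProgram → Set (f ⊔ v ⊔ p)
    Ds FlattensTo Ds′ = Pointwise (FlattensDecl Ds′) Ds Ds′

  TraitDef : Set f
  TraitDef = TraitName × List Method

  traitDecl : TraitDef → Decl
  traitDecl (t , Ms) = trait t , lit ⟨ Ms ⟩

  flatTraitDecl : TraitDef → FlatDecl
  flatTraitDecl (t , Ms) = trait t , ⟨ Ms ⟩

  -- (… (t₀ + t₁) + …) + tₙ
  sumOf : TraitName → List TraitName → TraitExpr
  sumOf t₀ ts = foldl (λ E t → E +ᴱ ref t) (ref t₀) ts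

{-# OPTIONS --safe #-}
-- Every concrete method of the class comes unchanged from one of the summed
-- traits t, where it was verified with this : t.  The class offers every method
-- of t with an at least as strong contract, so the same body can be typed again
-- with this : C: its knowledge entails the old knowledge and its obligation is
-- entailed by the old one.  Traits without interfaces have no proper supertype,
-- hence an expression of type t is just `this`, and the type of every other
-- expression is unaffected.
module Submission where

open import Defs
open import Data.Bool using (false)
open import Data.Empty using (⊥)
open import Data.List using (List; []; _∷_; _++_; map; foldl)
open import Data.List.Membership.Propositional using (_∈_)
open import Data.List.Membership.Propositional.Properties using (∈-++⁺ˡ; ∈-++⁺ʳ; ∈-++⁻; ∈-insert; ∈-map⁺; ∈-map⁻)
open import Data.List.Relation.Binary.Pointwise as Pointwise using (Pointwise; _∷_)
open import Data.List.Relation.Binary.Subset.Propositional using (_⊆_)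
open import Data.List.Relation.Unary.All as All using (All)
open import Data.List.Relation.Unary.AllPairs using (_∷_)
open import Data.List.Relation.Unary.Any using (here; there)
open import Data.List.Relation.Unary.Unique.Propositional using (Unique)
open import Data.Maybe using (just; nothing)
open import Data.Product using (∃-syntax; _×_; _,_; proj₁; proj₂)
open import Data.Sum as Sum using (_⊎_; inj₁; inj₂; [_,_]′)
open import Data.Unit using (⊤)
open import Data.Vec as Vec using (Vec; []; _∷_)
open import Data.Vec.Relation.Binary.Pointwise.Inductive using ([]; _∷_) renaming (Pointwise to Pointwiseᵛ)
open import Function using (id; _∘_)
open import Relation.Binary.Construct.Closure.ReflexiveTransitive using (ε; _◅_)
open import Relation.Binary.PropositionalEquality as ≡ using (_≡_; refl)
open import Relation.Nullary using (contradiction)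

-- Association lists, membership and aligned lists.

unique-value : ∀ {a b} {A : Set a} {B : Set b} {xs : List (A × B)} {k x y} →
  Unique (map proj₁ xs) → (k , x) ∈ xs → (k , y) ∈ xs → x ≡ y
unique-value _        (here refl) (here refl) = refl
unique-value (k∉ ∷ _) (here refl) (there j)   = contradiction refl (All.lookup k∉ (∈-map⁺ proj₁ j))
unique-value (k∉ ∷ _) (there i)   (here refl) = contradiction refl (All.lookup k∉ (∈-map⁺ proj₁ i))
unique-value (_ ∷ u)  (there i)   (there j)   = unique-value u i j

∈-++-weaken : ∀ {a} {A : Set a} {x y : A} xs {ys} → x ∈ xs ++ ys → x ∈ xs ++ y ∷ ys
∈-++-weaken xs = [ ∈-++⁺ˡ , ∈-++⁺ʳ xs ∘ there ]′ ∘ ∈-++⁻ xs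

∈-++-remove : ∀ {a} {A : Set a} {x y : A} xs {ys} → x ∈ xs ++ y ∷ ys → x ≡ y ⊎ x ∈ xs ++ ys
∈-++-remove xs i with ∈-++⁻ xs i
... | inj₁ j         = inj₂ (∈-++⁺ˡ j)
... | inj₂ (here eq) = inj₁ eq
... | inj₂ (there j) = inj₂ (∈-++⁺ʳ xs j)

-- Both prefixes are images of one list, hence equally long, so `y` and `z` face each other. This
-- picks the class declaration out of a flattening.
Pointwise-middle : ∀ {a b c r} {A : Set a} {B : Set b} {C : Set c} {R : A → B → Set r}
  {g : C → A} {h : C → B} {y z ys zs} (xs : List C) →
  Pointwise R (map g xs ++ y ∷ ys) (map h xs ++ z ∷ zs) → R y z
Pointwise-middle []       (r ∷ _)  = r
Pointwise-middle (_ ∷ xs) (_ ∷ rs) = Pointwise-middle xs rs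

-- Refinement of contracts under composition; the shape of sums.

module Composition {f v} (L : Logic f v) where
  open Logic L
  open Calculus L

  ≼-refl : ∀ {H} → H ≼ H
  ≼-refl = refines (⇒-refl , ⇒-refl)

  ≼-trans : ∀ {H₁ H₂ H₃} → H₁ ≼ H₂ → H₂ ≼ H₃ → H₁ ≼ H₃
  ≼-trans (refines (pre , post)) (refines (pre′ , post′)) =
    refines (⇒-trans pre′ pre , ⇒-trans post post′)

  -- The method half of `_Provides_`, on bare lists so that it can follow the recursion of `_+ˢ_≔_`.
  Covers : List Method → List Method → Set _
  Covers Ms Ms′ = ∀ M′ → M′ ∈ Ms′ → ∃[ M ] M ∈ Ms × head M ≼ head M′

  covers-∷ : ∀ {M Ms Ms′} → Covers Ms Ms′ → Covers (M ∷ Ms) Ms′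
  covers-∷ c M′ i with M , j , le ← c M′ i = M , there j , le

  Provides-refl : ∀ B → B Provides B
  Provides-refl B = id , λ M i → M , i , ≼-refl

  Provides-trans : ∀ B₁ B₂ B₃ → B₁ Provides B₂ → B₂ Provides B₃ → B₁ Provides B₃
  Provides-trans B₁ B₂ B₃ (Cs , c) (Cs′ , c′) = Cs ∘ Cs′ , covers
    where
    covers : Covers (methods B₁) (methods B₃)
    covers M₃ i with M₂ , j , le′ ← c′ M₃ i with M₁ , k , le ← c M₂ j =
      M₁ , k , ≼-trans le le′

  +ᵐ-refinesˡ : ∀ {M₁ M₂ M} → M₁ +ᵐ M₂ ≔ M → head M ≼ head M₁
  +ᵐ-refinesˡ (concrete-abstract _) = ≼-refl
  +ᵐ-refinesˡ (abstract-concrete r) = r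
  +ᵐ-refinesˡ (abstract-first _)    = ≼-refl
  +ᵐ-refinesˡ (abstract-second _ r) = r

  +ᵐ-refinesʳ : ∀ {M₁ M₂ M} → M₁ +ᵐ M₂ ≔ M → head M ≼ head M₂
  +ᵐ-refinesʳ (concrete-abstract r) = r
  +ᵐ-refinesʳ (abstract-concrete _) = ≼-refl
  +ᵐ-refinesʳ (abstract-first r)    = r
  +ᵐ-refinesʳ (abstract-second _ _) = ≼-refl

  +ᵐ-source : ∀ {M₁ M₂ M} → M₁ +ᵐ M₂ ≔ M → M ≡ M₁ ⊎ M ≡ M₂
  +ᵐ-source (concrete-abstract _) = inj₁ refl
  +ᵐ-source (abstract-concrete _) = inj₂ refl
  +ᵐ-source (abstract-first _)    = inj₁ refl
  +ᵐ-source (abstract-second _ _) = inj₂ refl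

  +ˢ-coversˡ : ∀ {Ms₁ Ms₂ Ms} → Ms₁ +ˢ Ms₂ ≔ Ms → Covers Ms Ms₁
  +ˢ-coversˡ (keep _ s)  _ (here refl) = _ , here refl , ≼-refl
  +ˢ-coversˡ (keep _ s)  _ (there i)   = covers-∷ (+ˢ-coversˡ s) _ i
  +ˢ-coversˡ (merge m s) _ (here refl) = _ , here refl , +ᵐ-refinesˡ m
  +ˢ-coversˡ (merge m s) _ (there i)   = covers-∷ (+ˢ-coversˡ s) _ i

  +ˢ-coversʳ : ∀ {Ms₁ Ms₂ Ms} → Ms₁ +ˢ Ms₂ ≔ Ms → Covers Ms Ms₂
  +ˢ-coversʳ done       M i = M , i , ≼-refl
  +ˢ-coversʳ (keep _ s)     = covers-∷ (+ˢ-coversʳ s)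
  -- The merged partner is covered by the new head; every other method of the second list is still
  -- there in the recursive composition.
  +ˢ-coversʳ (merge {Ms₂ = Ms₂} m s) M i with ∈-++-remove Ms₂ i
  ... | inj₁ refl = _ , here refl , +ᵐ-refinesʳ m
  ... | inj₂ j    = covers-∷ (+ˢ-coversʳ s) M j

  +ˢ-source : ∀ {Ms₁ Ms₂ Ms M} → Ms₁ +ˢ Ms₂ ≔ Ms → M ∈ Ms → M ∈ Ms₁ ⊎ M ∈ Ms₂
  +ˢ-source done        i           = inj₂ i
  +ˢ-source (keep _ s)  (here eq)   = inj₁ (here eq)
  +ˢ-source (keep _ s)  (there i)   = Sum.map₁ there (+ˢ-source s i)
  +ˢ-source (merge {Ms₂ = Ms₂} m s) (here refl) with +ᵐ-source m
  ... | inj₁ refl = inj₁ (here refl)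
  ... | inj₂ refl = inj₂ (∈-insert Ms₂)
  +ˢ-source (merge {Ms₂ = Ms₂} m s) (there i) =
    Sum.map there (∈-++-weaken Ms₂) (+ˢ-source s i)

  +ᴮ-providesˡ : ∀ {B₁ B₂ B} → B₁ +ᴮ B₂ ≔ B → B Provides B₁
  +ᴮ-providesˡ (compose s) = ∈-++⁺ˡ , +ˢ-coversˡ s

  +ᴮ-providesʳ : ∀ {B₁ B₂ B} → B₁ +ᴮ B₂ ≔ B → B Provides B₂
  +ᴮ-providesʳ (compose {Cs₁ = Cs₁} s) = ∈-++⁺ʳ Cs₁ , +ˢ-coversʳ s

  +ᴮ-source : ∀ {B₁ B₂ B M} → B₁ +ᴮ B₂ ≔ B → M ∈ methods B → M ∈ methods B₁ ⊎ M ∈ methods B₂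
  +ᴮ-source (compose s) = +ˢ-source s

  -- Literals and `makeAbstract` are excluded because they can yield methods that are not literally
  -- methods of a mentioned trait.
  IsSum : TraitExpr → Set
  IsSum (lit _)            = ⊥
  IsSum (ref _)            = ⊤
  IsSum (E₁ +ᴱ E₂)         = IsSum E₁ × IsSum E₂
  IsSum (makeAbstract _ _) = ⊥

  sumOf-isSum : ∀ t ts → IsSum (sumOf t ts)
  sumOf-isSum t = go (ref t) _
    where
    -- `foldl` changes its accumulator at each step, so the induction has to range over all
    -- accumulators.
    go : ∀ E → IsSum E → ∀ ts → IsSum (foldl (λ E t → E +ᴱ ref t) E ts)
    go E s []       = s
    go E s (t ∷ ts) = go (E +ᴱ ref t) (s , _) ts

  sumOf-mentions : ∀ t ts {t′} → Mentions (sumOf t ts) t′ → t′ ∈ t ∷ ts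
  sumOf-mentions t ts m with go (ref t) ts m
    where
    go : ∀ E ts {t′} → Mentions (foldl (λ E t → E +ᴱ ref t) E ts) t′ → Mentions E t′ ⊎ t′ ∈ ts
    go E []       m = inj₁ m
    go E (t ∷ ts) m with go (E +ᴱ ref t) ts m
    ... | inj₁ (inj₁ n)    = inj₁ n
    ... | inj₁ (inj₂ refl) = inj₂ (here refl)
    ... | inj₂ i           = inj₂ (there i)
  ... | inj₁ refl = here refl
  ... | inj₂ i    = there i

-- Retyping a method body with the class in place of the trait.

module Retyping {f v p} (L : Logic f v) (𝒱 : Calculus.Verifier L p) where
  open Logic L
  open Calculus L
  open Verifier 𝒱
  open Verification 𝒱
  open Composition L

  ⊨-refl : ∀ {Ds V} {P : Formula V} → Ds ⊢ P ⊨ P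
  ⊨-refl = logical ⇒-refl

  &-mono : ∀ {Ds V} {P P′ Q Q′ : Formula V} → Ds ⊢ P ⊨ P′ → Ds ⊢ Q ⊨ Q′ → Ds ⊢ P & Q ⊨ P′ & Q′
  &-mono p q = conj (cut (logical &-E) p) (cut (logical (⇒-trans &-comm &-E)) q)

  -- Turns a refinement of contracts into an entailment between the formulas "precondition implies
  -- postcondition" that calls contribute to the knowledge. In the proof, `uncurry ⇒-refl` is modus
  -- ponens.
  ⇒-mono : ∀ {V} {P P′ Q Q′ : Formula V} →
    Valid (P′ ⇒ P) → Valid (Q ⇒ Q′) → Valid ((P ⇒ Q) ⇒ (P′ ⇒ Q′))
  ⇒-mono p q = curry (⇒-trans (⇒-trans (&-I &-E (⇒-trans (⇒-trans &-comm &-E) p)) (uncurry ⇒-refl)) q)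

  ⇒-[] : ∀ {V W} {P Q : Formula V} (σ : V → W) → Valid (P ⇒ Q) → Valid (P [ σ ] ⇒ Q [ σ ])
  ⇒-[] σ v = ≡.subst Valid ([]-⇒ _ _ σ) (valid-[] σ v)

  Entails : FlatProgram → ∀ {V} → Formula V → Formula V → Set p
  Entails Ds P Q = Ds ⊢ P ⊨ Q

  ⋀ᵛ-mono : ∀ {Ds n k} {Ps Qs : Vec (Formula (LVar n)) k} →
    Pointwiseᵛ (Entails Ds) Ps Qs → Ds ⊢ ⋀ᵛ Ps ⊨ ⋀ᵛ Qs
  ⋀ᵛ-mono []       = ⊨-refl
  ⋀ᵛ-mono (r ∷ rs) = &-mono r (⋀ᵛ-mono rs)

  results-mono : ∀ {Ds n k} {Ps Qs : Vec (Formula (LVar n)) k} → Pointwiseᵛ (Entails Ds) Ps Qs →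
    ∀ xs → Pointwiseᵛ (Entails Ds) (Vec.zipWith _[result:=_] Ps xs) (Vec.zipWith _[result:=_] Qs xs)
  results-mono []       []       = []
  results-mono (r ∷ rs) (x ∷ xs) = subst _ r ∷ results-mono rs xs

  zipWith-&-monoˡ : ∀ {Ds n k} {Ps Qs : Vec (Formula (LVar n)) k} → Pointwiseᵛ (Entails Ds) Ps Qs →
    ∀ Rs → Pointwiseᵛ (Entails Ds) (Vec.zipWith _&_ Ps Rs) (Vec.zipWith _&_ Qs Rs)
  zipWith-&-monoˡ []       []       = []
  zipWith-&-monoˡ (r ∷ rs) (R ∷ Rs) = &-mono r ⊨-refl ∷ zipWith-&-monoˡ rs Rs

  module _ {Ds : FlatProgram} {t : TraitName} {Bₜ : Body} {C : ClassName} {B : Body}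
           (uniqueNames : Unique (map proj₁ Ds))
           (t∈ : (trait t , Bₜ) ∈ Ds) (no-supertypes : implements Bₜ ≡ [])
           (C∈ : (class C , B) ∈ Ds) (not-interface : interface? B ≡ false)
           (provides : B Provides Bₜ) where

    -- How the type of an expression changes when `this` moves from trait to class. No other trait
    -- arises: parameters, return types, created objects and proper supertypes are all classes.
    data Retarget : Name → Name → Set where
      self  : Retarget (trait t) (class C)
      other : ∀ {D} → Retarget (class D) (class D)

    -- A chain from the trait is empty, since the trait implements nothing; a chain from a class
    -- stays among classes and is reused.
    retarget-<: : ∀ {N N₁ N′} → Retarget N N₁ → Ds ⊢ N <: N′ → ∃[ N₁′ ] Retarget N′ N₁′ × Ds ⊢ N₁ <: N₁′
    retarget-<: r ε = _ , r , ε
    retarget-<: self ((B′ , D , refl , t∈′ , D∈) ◅ _)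
      with refl ← unique-value uniqueNames t∈ t∈′
      with () ← ≡.subst (D ∈_) no-supertypes D∈
    retarget-<: other (s@(_ , _ , refl , _) ◅ ss) with N₁′ , r , ss′ ← retarget-<: other ss =
      N₁′ , r , s ◅ ss′

    retarget-method : ∀ {N N₁ B′ M} → Retarget N N₁ → (N , B′) ∈ Ds → M ∈ methods B′ →
      ∃[ B₁ ] ∃[ M₁ ] (N₁ , B₁) ∈ Ds × M₁ ∈ methods B₁ × head M₁ ≼ head M
    retarget-method other N∈ M∈ = _ , _ , N∈ , M∈ , ≼-refl
    retarget-method self N∈ M∈ with refl ← unique-value uniqueNames t∈ N∈
      with M₁ , M₁∈ , le ← proj₂ provides _ M∈ = B , M₁ , C∈ , M₁∈ , le

    -- Here modularity of the verifier enters.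
    retarget-⊨ : ∀ {N N₁ V} {x : V} → Retarget N N₁ → Ds ⊢ x ∶ N₁ ⊨ x ∶ N
    retarget-⊨ self  = modular _ C∈ not-interface t∈ provides
    retarget-⊨ other = ⊨-refl

    retarget-ctx : ∀ {n} (Cs : Vec ClassName n) x → Retarget (ctx (trait t) Cs x) (ctx (class C) Cs x)
    retarget-ctx Cs this    = self
    retarget-ctx Cs (arg _) = other

    mutual
      -- Knowledge may only grow and obligations only shrink. The list `F` stays the same, so every
      -- freshness condition carries over.
      retype : ∀ {n} {Cs : Vec ClassName n} {e N P P′ F} →
        Ds , ctx (trait t) Cs ⊢ e ∶ N ⊣ P ⊨ P′ ∣ F →
        ∃[ N₁ ] ∃[ P₁ ] ∃[ P₁′ ] Retarget N N₁ ×
          Ds , ctx (class C) Cs ⊢ e ∶ N₁ ⊣ P₁ ⊨ P₁′ ∣ F × Ds ⊢ P₁ ⊨ P × Ds ⊢ P′ ⊨ P₁′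
      retype {Cs = Cs} (t-var x) =
        _ , _ , _ , retarget-ctx Cs x , t-var x , &-mono (retarget-⊨ (retarget-ctx Cs x)) ⊨-refl , ⊨-refl
      retype (t-call {M = method _ _} {x₀ = x₀} {xs = xs} d₀ N∈ M∈ ds u)
        with _ , _ , _ , r , d₀′ , k₀ , o₀ ← retype d₀
        with _ , _ , ds′ , ks , os ← retype* ds
        -- Matching `refines` identifies name, parameters and return type of the two methods, so the
        -- same call is typed and only the contract differs.
        with _ , method _ _ , N₁∈ , M₁∈ , refines (pre , post) ← retarget-method r N∈ M∈ =
        _ , _ , _ , other , t-call {x₀ = x₀} {xs = xs} d₀′ N₁∈ M₁∈ ds′ u
        , &-mono ⊨-refl (&-mono (subst _ k₀) (&-mono (⋀ᵛ-mono (results-mono ks xs))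
            (logical (⇒-mono (⇒-[] _ pre) (⇒-[] _ post)))))
        , &-mono o₀ (&-mono (⋀ᵛ-mono os) (logical (⇒-[] _ pre)))
      retype (t-new {gs = gs} {xs = xs} D∈ ni am ds u)
        with _ , _ , ds′ , ks , os ← retype* ds =
        _ , _ , _ , other , t-new {gs = gs} {xs = xs} D∈ ni am ds′ u
        , &-mono ⊨-refl (⋀ᵛ-mono (zipWith-&-monoˡ (results-mono ks xs) _))
        , &-mono (⋀ᵛ-mono os) ⊨-refl
      retype (t-sub d s)
        with _ , _ , _ , r , d′ , k , o ← retype d
        with _ , r′ , s′ ← retarget-<: r s = _ , _ , _ , r′ , t-sub d′ s′ , k , o

      retype* : ∀ {n k} {Cs : Vec ClassName n} {es : Vec (Expr n) k} {Ts Ps Ps′ F} →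
        Ds , ctx (trait t) Cs ⊢* es ∶ Ts ⊣ Ps ⊨ Ps′ ∣ F →
        ∃[ Ps₁ ] ∃[ Ps₁′ ] Ds , ctx (class C) Cs ⊢* es ∶ Ts ⊣ Ps₁ ⊨ Ps₁′ ∣ F ×
          Pointwiseᵛ (Entails Ds) Ps₁ Ps × Pointwiseᵛ (Entails Ds) Ps′ Ps₁′
      retype* [] = _ , _ , [] , [] , []
      -- Arguments are expected at class types, which leaves `other` as the only case and keeps `Ts`
      -- fixed.
      retype* (d ∷ ds) with _ , _ , _ , other , d′ , k , o ← retype d
        with _ , _ , ds′ , ks , os ← retype* ds = _ , _ , d′ ∷ ds′ , k ∷ ks , o ∷ os

    methodOK-inherited : ∀ M → MethodOK Ds (trait t) M → MethodOK Ds (class C) M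
    methodOK-inherited (method H nothing)  _ = _
    methodOK-inherited (method H (just e)) (_ , _ , _ , d , verified)
      with _ , _ , _ , other , d′ , k , o ← retype d =
      _ , _ , _ , d′ ,
      -- The two contexts differ only in the conjunct for `this`. The new hypotheses entail the old
      -- ones, and the old conclusion entails the new one.
      cut (&-mono (&-mono (retarget-⊨ self) ⊨-refl) (&-mono ⊨-refl k)) (cut verified (&-mono o ⊨-refl))

  -- Flattened sums and the origin of their methods.

  sum-source : ∀ {Ds N E B M} → IsSum E → Ds ؛ N ⊢ E ⇓ B → M ∈ methods B →
    ∃[ t ] ∃[ Bₜ ] Mentions E t × (trait t , Bₜ) ∈ Ds × M ∈ methods Bₜ × B Provides Bₜ
  sum-source _ (flat-ref {B = B} t∈) M∈ = _ , _ , refl , t∈ , M∈ , Provides-refl B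
  -- `M` comes unchanged from one operand, and the composed body provides that operand, so
  -- transitivity reaches the trait of origin.
  sum-source (s₁ , s₂) (flat-+ {B₁ = B₁} {B₂ = B₂} {B = B} d₁ d₂ +≔) M∈ with +ᴮ-source +≔ M∈
  ... | inj₁ M∈₁ with t , Bₜ , m , t∈ , M∈ₜ , pr ← sum-source s₁ d₁ M∈₁ =
    t , Bₜ , inj₁ m , t∈ , M∈ₜ , Provides-trans B B₁ Bₜ (+ᴮ-providesˡ +≔) pr
  ... | inj₂ M∈₂ with t , Bₜ , m , t∈ , M∈ₜ , pr ← sum-source s₂ d₂ M∈₂ =
    t , Bₜ , inj₂ m , t∈ , M∈ₜ , Provides-trans B B₂ Bₜ (+ᴮ-providesʳ +≔) pr

  sum-not-interface : ∀ {Ds N E B} → IsSum E →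
    (∀ {t Bₜ} → Mentions E t → (trait t , Bₜ) ∈ Ds → interface? Bₜ ≡ false) →
    Ds ؛ N ⊢ E ⇓ B → interface? B ≡ false
  sum-not-interface _ traits (flat-ref t∈)            = traits refl t∈
  sum-not-interface _ _      (flat-+ _ _ (compose _)) = refl

  -- Transfers uniqueness of names from the source program to the flattened one.
  flattening-names : ∀ {Ds Ds′} → Ds FlattensTo Ds′ → map proj₁ Ds ≡ map proj₁ Ds′
  flattening-names = Pointwise.Pointwise-≡⇒≡ ∘ Pointwise.map⁺ proj₁ proj₁ ∘ Pointwise.map proj₁

  sum-bodyOK : ∀ {Ds C E B} (defs : List TraitDef) → Unique (map proj₁ Ds) →
    map flatTraitDecl defs ⊆ Ds → (class C , B) ∈ Ds → IsSum E →
    (∀ {t} → Mentions E t → t ∈ map proj₁ defs) →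
    All (λ (t , Ms) → BodyOK Ds (trait t) ⟨ Ms ⟩) defs →
    Ds ؛ class C ⊢ E ⇓ B → BodyOK Ds (class C) B
  sum-bodyOK {Ds} {C} {E} {B} defs unique defs⊆ C∈ isSum mentions ok flat = All.tabulate methodOK
    where
    -- Since names are unique, the body that flattening looks up is the one listed in `defs`, which
    -- `ok` covers.
    definition : ∀ {t Bₜ} → Mentions E t → (trait t , Bₜ) ∈ Ds → ∃[ Ms ] Bₜ ≡ ⟨ Ms ⟩ × (t , Ms) ∈ defs
    definition m t∈ with (_ , Ms) , d∈ , refl ← ∈-map⁻ proj₁ (mentions m) =
      Ms , unique-value unique t∈ (defs⊆ (∈-map⁺ flatTraitDecl d∈)) , d∈

    trait-not-interface : ∀ {t Bₜ} → Mentions E t → (trait t , Bₜ) ∈ Ds → interface? Bₜ ≡ false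
    trait-not-interface m t∈ with _ , refl , _ ← definition m t∈ = refl

    methodOK : ∀ {M} → M ∈ methods B → MethodOK Ds (class C) M
    methodOK M∈ with _ , _ , m , t∈ , M∈ₜ , provides ← sum-source isSum flat M∈
      with _ , refl , d∈ ← definition m t∈ =
      -- The `refl` says that a body of the form `⟨ Ms ⟩` implements no interface.
      methodOK-inherited unique t∈ refl C∈ (sum-not-interface isSum trait-not-interface flat) provides _
        (All.lookup (All.lookup ok d∈) M∈ₜ)

theorem4p9 : ∀ {f v p} (L : Logic f v) → let open Calculus L in (𝒱 : Verifier p) → let open Verification 𝒱 in
    (t₀ : TraitName) (MH : Header) (ts : List TraitDef) (C : ClassName) (B : Body)
    (Ds : Program) (Ds′ : FlatProgram) →
    let defs  = (t₀ , abstractMethod MH ∷ []) ∷ ts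
        prog  = map traitDecl defs ++ (class C , sumOf t₀ (map proj₁ ts)) ∷ Ds
        prog′ = map flatTraitDecl defs ++ (class C , B) ∷ Ds′
    in
    WellFormed prog →
    All (λ (t , Ms) → BodyOK prog′ (trait t) ⟨ Ms ⟩) defs →
    prog FlattensTo prog′ →
    BodyOK prog′ (class C) B
theorem4p9 L 𝒱 t₀ MH ts C B Ds Ds′ wf ok flat =
  sum-bodyOK defs (≡.subst Unique (flattening-names flat) (WellFormed.uniqueNames wf))
    ∈-++⁺ˡ (∈-insert (map flatTraitDecl defs))
    (sumOf-isSum t₀ (map proj₁ ts)) (sumOf-mentions t₀ (map proj₁ ts)) ok
    (proj₁ (proj₂ (Pointwise-middle defs flat)))
  where
  open Calculus L
  open Composition L
  open Retyping L 𝒱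
  defs = (t₀ , abstractMethod MH ∷ []) ∷ ts
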